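{- Let $M$ be a doxastic Kripke model and let $w$ be a world in $M$. (1) If $M\in\mathcal{K}_n^{te}$ (i.e. $M$ is local, proper, transitive and Euclidean), then for all $\varphi\in\mathcal{L}_B$: $M,w\models_{K}\varphi$ if and only if $\mathfrak{H}(M),E_w\models_{H}\varphi$. (2) If $M\in\mathcal{K}_n^{ste}$ (i.e. $M$ is local, proper, serial, transitive and Euclidean), then for all $\varphi\in\mathcal{L}_B^K$: $M,w\models_{K}\varphi$ if and only if $\mathfrak{H}(M),E_w\models_{H}\varphi$. Here $\mathfrak{H}(M)$ is the hypergraph model associated with $M$ and $E_w$ is its hyperedge corresponding to $w$.
   Context: Fix a set $\mathcal{A}$ of $n\geq 1$ agents (finite, $|\mathcal{A}|=n$). Each $a\in\mathcal{A}$ has a countable set $\mathsf{Var}_a$ of propositional letters; these sets are pairwise disjoint, and $\mathsf{Var}:=\bigcup_{a\in\mathcal{A}}\mathsf{Var}_a$. The language $\mathcal{L}_B^K$ is generated by $\varphi::=p\mid\neg\varphi\mid\varphi\wedge\varphi\mid B_a\varphi\mid K_a\varphi$ ($p\in\mathsf{Var}$, $a\in\mathcal{A}$); $\mathcal{L}_B$ is its fragment without the operators $K_a$. Kripke models. A doxastic Kripke model is a triple $M=(W,R,V)$ with $W\neq\emptyset$ a set, $R$ assigning to each $a\in\mathcal{A}$ a relation $R_a\subseteq W\times W$, and $V:W\to\mathcal{P}(\mathsf{Var})$. It is serial/transitive/Euclidean if every $R_a$ is (Euclidean: $uR_av$ and $uR_aw$ imply $vR_aw$). For a relation $S$, $S^{\leftrightarrow}:=S\cup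 S^{ -1}$ and $S^{\equiv}$ is the smallest equivalence relation containing $S$. $M$ is proper if for all $u\neq v$ in $W$ there is $a\in\mathcal{A}$ with $(u,v)\notin R_a^{\equiv}$. $M$ is local if for all $a\in\mathcal{A}$, $u,v\in W$: $(u,v)\in R_a^{\leftrightarrow}$ implies $V(u)\cap\mathsf{Var}_a=V(v)\cap\mathsf{Var}_a$. Satisfaction: $M,w\models_Kp$ iff $p\in V(w)$; $\neg,\wedge$ as usual; $M,w\models_KB_a\varphi$ iff $M,u\models_K\varphi$ for all $u$ with $wR_au$; $M,w\models_KK_a\varphi$ iff $M,u\models_K\varphi$ for all $u$ with $wR_a^{\equiv}u$. Hypergraph models. A directed hyperedge over a set $\mathscr{V}$ is a pair $E=(X,Y)$ of finite disjoint (possibly empty) subsets of $\mathscr{V}$; $T(E):=X$, $H(E):=Y$, $U(E):=T(E)\cup H(E)$. A directed hypergraph is a pair $G=(\mathscr{V}(G),\mathscr{E}(G))$ with $\mathscr{V}(G)$ a non-empty set and $\mathscr{E}(G)$ a set of directed hyperedges over it. A coloring of $G$ is a map $\chi:\mathscr{V}(G)\to\mathcal{A}$ such that distinct vertices in $U(E)$ have distinct colors, for every $E\in\mathscr{E}(G)$. A hypergraph model is a triple $N=(G,\chi,\ell)$ with $G$ a directed hypergraph, $\chi$ a coloring of $G$, and $\ell:\mathscr{V}(G)\to\mathcal{P}(\mathsf{Var})$ such that $\chi(u)=a$ implies $\ell(u)\subseteq\mathsf{Var}_a$. Put $\ell(E):=\bigcup_{u\in U(E)}\ell(u)$. For $E_1,E_2\in\mathscr{E}(G)$: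 $E_1\vartriangleright_aE_2$ iff some $u\in U(E_1)\cap T(E_2)$ has $\chi(u)=a$; $E_1\approx_aE_2$ iff some $u\in U(E_1)\cap U(E_2)$ has $\chi(u)=a$. Satisfaction: $N,E\models_Hp$ iff $p\in\ell(E)$; $\neg,\wedge$ as usual; $N,E\models_HB_a\varphi$ iff $N,E'\models_H\varphi$ for all $E'\in\mathscr{E}(G)$ with $E\vartriangleright_aE'$; $N,E\models_HK_a\varphi$ iff $N,E'\models_H\varphi$ for all $E'\in\mathscr{E}(G)$ with $E\approx_aE'$. The model $\mathfrak{H}(M)$. Let $M=(W,R,V)$ be a local doxastic Kripke model. For each $(a,u)\in\mathcal{A}\times W$ let $x_u^a$ be a fresh element (distinct for distinct pairs), and let $[x_u^a]$ be its class under the equivalence relation $\{(x_u^a,x_v^a)\mid a\in\mathcal{A},(u,v)\in R_a^{\equiv}\}$. For $u\in W$ put $X_u:=\{[x_u^a]\mid a\in\mathcal{A},(u,u)\in R_a\}$, $Y_u:=\{[x_u^a]\mid a\in\mathcal{A},(u,u)\notin R_a\}$ and $E_u:=(X_u,Y_u)$. Then $\mathfrak{H}(M)=(G,\chi,\ell)$ with $\mathscr{V}(G)=\{[x_u^a]\mid a\in\mathcal{A},u\in W\}$, $\mathscr{E}(G)=\{E_u\mid u\in W\}$, $\chi([x_u^a]):=a$, and $\ell([x_u^a]):=V(u)\cap\mathsf{Var}_a$ (these are well defined). -}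

module Defs where

open import Axiom.ExcludedMiddle using (ExcludedMiddle)
open import Data.Fin.Base using (Fin; zero)
open import Data.List.Base using (List; map; filter; allFin)
open import Data.List.Membership.Propositional.Properties using (∈-allFin; ∈-filter⁺; ∈-filter⁻)
open import Data.List.Relation.Unary.Any as Any using ()
import Data.List.Membership.Propositional as ListMem
import Data.List.Membership.Setoid as SetoidMem
import Data.List.Relation.Unary.Any.Properties as AnyP
open import Data.Nat.Base using (ℕ; NonZero; suc)
open import Data.Product using (Σ; ∃; _×_; _,_; proj₁; proj₂)
open import Data.Sum using (inj₁; inj₂)
open import Function.Bundles using (_↣_)
open import Level as L using (Level; Lift)
open import Relation.Binary.Bundles using (Setoid)
open import Relation.Binary.Core using (Rel)
open import Relation.Binary.Definitions using (Transitive; _Respects_)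
open import Relation.Binary.Construct.Closure.Equivalence using (EqClosure)
open import Relation.Binary.Construct.Closure.ReflexiveTransitive using (ε; _◅_)
open import Relation.Binary.Construct.Closure.Symmetric using (SymClosure)
import Relation.Binary.Construct.Closure.Equivalence as Eq
open import Relation.Binary.PropositionalEquality using (_≡_; _≢_; refl)
open import Relation.Nullary using (¬_; Dec)
open import Relation.Unary using (Pred; _∈_; _⊆_; _∪_; _∩_; _≐_; _⊥_)

-- The letters of distinct agents are made disjoint by tagging: a letter is a
-- pair of an agent and one of its own letters.
record Signature : Set₁ where
  field
    n           : ℕ
    ⦃ n-nonZero ⦄ : NonZero n
    OwnLetter   : Fin n → Set
    countable   : ∀ a → OwnLetter a ↣ ℕ

  Agent : Set
  Agent = Fin n

  Var : Set
  Var = Σ Agent OwnLetter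

  VarOf : Agent → Pred Var L.zero
  VarOf a p = proj₁ p ≡ a

module _ (S : Signature) where
  open Signature S

  data Formula : Set where
    var : Var → Formula
    neg : Formula → Formula
    _∧_ : Formula → Formula → Formula
    B   : Agent → Formula → Formula
    K   : Agent → Formula → Formula

module _ {S : Signature} where
  open Signature S

  data KFree : Pred (Formula S) L.zero where
    var : ∀ p → KFree (var p)
    neg : ∀ {φ} → KFree φ → KFree (neg φ)
    _∧_ : ∀ {φ ψ} → KFree φ → KFree ψ → KFree (φ ∧ ψ)
    B   : ∀ a {φ} → KFree φ → KFree (B a φ)

record KripkeModel (S : Signature) (ℓ : Level) : Set (L.suc ℓ) where
  open Signature S
  field
    W        : Set ℓ
    nonEmpty : W
    R        : Agent → Rel W ℓ
    V        : W → Pred Var ℓ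

  _R↔⟨_⟩_ : W → Agent → W → Set ℓ
  u R↔⟨ a ⟩ v = SymClosure (R a) u v

  _R≡⟨_⟩_ : W → Agent → W → Set ℓ
  u R≡⟨ a ⟩ v = EqClosure (R a) u v

module _ {S : Signature} {ℓ : Level} (M : KripkeModel S ℓ) where
  open Signature S
  open KripkeModel M

  IsSerial : Set ℓ
  IsSerial = ∀ a u → ∃ λ v → R a u v

  IsTransitive : Set ℓ
  IsTransitive = ∀ a → Transitive (R a)

  IsEuclidean : Set ℓ
  IsEuclidean = ∀ a {u v w} → R a u v → R a u w → R a v w

  IsProper : Set ℓ
  IsProper = ∀ {u v} → u ≢ v → ∃ λ a → ¬ (u R≡⟨ a ⟩ v)

  IsLocal : Set ℓ
  IsLocal = ∀ a {u v} → u R↔⟨ a ⟩ v → V u ∩ VarOf a ≐ V v ∩ VarOf a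

  record InKte : Set ℓ where
    field
      isLocal      : IsLocal
      isProper     : IsProper
      isTransitive : IsTransitive
      isEuclidean  : IsEuclidean

  record InKste : Set ℓ where
    field
      isLocal      : IsLocal
      isProper     : IsProper
      isSerial     : IsSerial
      isTransitive : IsTransitive
      isEuclidean  : IsEuclidean

infix 3 _⨾_⊨ᴷ_
_⨾_⊨ᴷ_ : ∀ {S ℓ} (M : KripkeModel S ℓ) → KripkeModel.W M → Formula S → Set ℓ
M ⨾ w ⊨ᴷ var p   = p ∈ KripkeModel.V M w
M ⨾ w ⊨ᴷ neg φ   = ¬ (M ⨾ w ⊨ᴷ φ)
M ⨾ w ⊨ᴷ (φ ∧ ψ) = (M ⨾ w ⊨ᴷ φ) × (M ⨾ w ⊨ᴷ ψ)
M ⨾ w ⊨ᴷ B a φ   = ∀ u → R a w u → M ⨾ u ⊨ᴷ φ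
  where open KripkeModel M
M ⨾ w ⊨ᴷ K a φ   = ∀ u → w R≡⟨ a ⟩ u → M ⨾ u ⊨ᴷ φ
  where open KripkeModel M

-- The vertices of 𝔥 M are equivalence classes, so a vertex set is a setoid and
-- its subsets are predicates respecting the setoid equality.

module _ {ℓ : Level} (𝒱 : Setoid ℓ ℓ) where
  open Setoid 𝒱 using (Carrier; _≈_)

  IsFinite : Pred Carrier ℓ → Set ℓ
  IsFinite P = ∃ λ (xs : List Carrier) → P ≐ (λ x → SetoidMem._∈_ 𝒱 x xs)

  record Hyperedge : Set (L.suc ℓ) where
    field
      T        : Pred Carrier ℓ
      H        : Pred Carrier ℓ
      T-resp   : T Respects _≈_
      H-resp   : H Respects _≈_
      T-finite : IsFinite T
      H-finite : IsFinite H
      disjoint : T ⊥ H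

    U : Pred Carrier ℓ
    U = T ∪ H

  infix 4 _≋_
  _≋_ : Hyperedge → Hyperedge → Set ℓ
  E ≋ E′ = (Hyperedge.T E ≐ Hyperedge.T E′) × (Hyperedge.H E ≐ Hyperedge.H E′)

record Hypergraph (ℓ : Level) : Set (L.suc ℓ) where
  field
    𝒱        : Setoid ℓ ℓ
    nonEmpty : Setoid.Carrier 𝒱
    ℰ        : Pred (Hyperedge 𝒱) ℓ
    ℰ-resp   : ℰ Respects (_≋_ 𝒱)

  Edge : Set (L.suc ℓ)
  Edge = Σ (Hyperedge 𝒱) ℰ

  open Setoid 𝒱 public using (_≈_) renaming (Carrier to Vertex)

  T U : Edge → Pred Vertex ℓ
  T (E , _) = Hyperedge.T E
  U (E , _) = Hyperedge.U E

record HypergraphModel (S : Signature) (ℓ : Level) : Set (L.suc ℓ) where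
  open Signature S
  field
    G : Hypergraph ℓ
  open Hypergraph G public
  field
    χ          : Vertex → Agent
    χ-resp     : ∀ {x y} → x ≈ y → χ x ≡ χ y
    χ-coloring : ∀ (E : Edge) {x y} → x ∈ U E → y ∈ U E → ¬ (x ≈ y) → χ x ≢ χ y
    label      : Vertex → Pred Var ℓ
    label-resp : ∀ {x y} → x ≈ y → label x ≐ label y
    label-own  : ∀ {x a} → χ x ≡ a → label x ⊆ VarOf a

  labelᴱ : Edge → Pred Var ℓ
  labelᴱ E p = ∃ λ x → x ∈ U E × p ∈ label x

  _▷⟨_⟩_ : Edge → Agent → Edge → Set ℓ
  E₁ ▷⟨ a ⟩ E₂ = ∃ λ x → x ∈ U E₁ ∩ T E₂ × χ x ≡ a

  _≈⟨_⟩_ : Edge → Agent → Edge → Set ℓ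
  E₁ ≈⟨ a ⟩ E₂ = ∃ λ x → x ∈ U E₁ ∩ U E₂ × χ x ≡ a

-- Lift only adjusts the universe level: hyperedges are large.
infix 3 _⨾_⊨ᴴ_
_⨾_⊨ᴴ_ : ∀ {S ℓ} (N : HypergraphModel S ℓ) → HypergraphModel.Edge N →
          Formula S → Set (L.suc ℓ)
_⨾_⊨ᴴ_ {ℓ = ℓ} N E (var p) = Lift (L.suc ℓ) (p ∈ HypergraphModel.labelᴱ N E)
N ⨾ E ⊨ᴴ neg φ   = ¬ (N ⨾ E ⊨ᴴ φ)
N ⨾ E ⊨ᴴ (φ ∧ ψ) = (N ⨾ E ⊨ᴴ φ) × (N ⨾ E ⊨ᴴ ψ)
N ⨾ E ⊨ᴴ B a φ   = ∀ (E′ : Edge) → E ▷⟨ a ⟩ E′ → N ⨾ E′ ⊨ᴴ φ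
  where open HypergraphModel N
N ⨾ E ⊨ᴴ K a φ   = ∀ (E′ : Edge) → E ≈⟨ a ⟩ E′ → N ⨾ E′ ⊨ᴴ φ
  where open HypergraphModel N

-- Excluded middle makes the sets X u and Y u finite: listing them requires
-- deciding R a u u.
module Associated {S : Signature} {ℓ : Level} (em : ExcludedMiddle ℓ)
                  (M : KripkeModel S ℓ) (isLocal : IsLocal M) where
  open Signature S
  open KripkeModel M

  -- The pair (a , u) stands for the element x_u^a.
  data _~_ : Rel (Agent × W) ℓ where
    same : ∀ {a u v} → u R≡⟨ a ⟩ v → (a , u) ~ (a , v)

  𝒱 : Setoid ℓ ℓ
  𝒱 = record
    { Carrier       = Agent × W
    ; _≈_           = _~_
    ; isEquivalence = record
      { refl  = same (Eq.reflexive _)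
      ; sym   = λ { (same r) → same (Eq.symmetric _ r) }
      ; trans = λ { (same r) (same s) → same (Eq.transitive _ r s) }
      }
    }
  open Setoid 𝒱 using () renaming (sym to ~-sym; trans to ~-trans)

  Classes : W → Pred Agent ℓ → Pred (Agent × W) ℓ
  Classes u P x = ∃ λ a → P a × x ~ (a , u)

  X Y : W → Pred (Agent × W) ℓ
  X u = Classes u (λ a → R a u u)
  Y u = Classes u (λ a → ¬ R a u u)

  Classes-resp : ∀ u P → Classes u P Respects _~_
  Classes-resp u P x~y (a , Pa , x~au) = a , Pa , ~-trans (~-sym x~y) x~au

  Classes-finite : ∀ u P → IsFinite 𝒱 (Classes u P)
  Classes-finite u P = map (_, u) agents , to , from
    where
    P? : ∀ a → Dec (P a)
    P? a = em
    agents : List Agent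
    agents = filter P? (allFin n)
    to : ∀ {x} → Classes u P x → SetoidMem._∈_ 𝒱 x (map (_, u) agents)
    to (a , Pa , x~au) =
      AnyP.map⁺ (Any.map (λ { refl → x~au }) (∈-filter⁺ P? (∈-allFin a) Pa))
    from : ∀ {x} → SetoidMem._∈_ 𝒱 x (map (_, u) agents) → Classes u P x
    from x∈ with ListMem.find (AnyP.map⁻ x∈)
    ... | a , a∈ , x~au = a , proj₂ (∈-filter⁻ P? {xs = allFin n} a∈) , x~au

  hyperedge : W → Hyperedge 𝒱
  hyperedge u = record
    { T        = X u
    ; H        = Y u
    ; T-resp   = Classes-resp u _
    ; H-resp   = Classes-resp u _
    ; T-finite = Classes-finite u _
    ; H-finite = Classes-finite u _
    ; disjoint = λ { ((a , Raa , same _) , (_ , ¬Raa , same _)) → ¬Raa Raa }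
    }

  graph : Hypergraph ℓ
  graph = record
    { 𝒱        = 𝒱
    ; nonEmpty = agent n , nonEmpty
    ; ℰ        = λ E → ∃ λ u → _≋_ 𝒱 E (hyperedge u)
    ; ℰ-resp   = λ { ((p , q) , (r , s)) (u , (p′ , q′) , (r′ , s′)) →
        u , ((λ z → p′ (q z)) , (λ z → p (q′ z)))
          , ((λ z → r′ (s z)) , (λ z → r (s′ z))) }
    }
    where
    agent : ∀ m → ⦃ NonZero m ⦄ → Fin m
    agent (suc _) = zero

  open Hypergraph graph using (Edge; U)

  U-class : ∀ u {x} → x ∈ Hyperedge.U (hyperedge u) → x ~ (proj₁ x , u)
  U-class u (inj₁ (a , _ , same r)) = same r
  U-class u (inj₂ (a , _ , same r)) = same r

  edge-class : ∀ (E : Edge) {x} → x ∈ U E → x ~ (proj₁ x , proj₁ (proj₂ E))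
  edge-class (E , u , (p , _) , _) (inj₁ t) = U-class u (inj₁ (p t))
  edge-class (E , u , _ , (r , _)) (inj₂ h) = U-class u (inj₂ (r h))

  coloring : ∀ (E : Edge) {x y} → x ∈ U E → y ∈ U E → ¬ (x ~ y) → proj₁ x ≢ proj₁ y
  coloring E x∈ y∈ x≁y refl = x≁y (~-trans (edge-class E x∈) (~-sym (edge-class E y∈)))

  label-invariant : ∀ a {u v} → u R≡⟨ a ⟩ v → V u ∩ VarOf a ≐ V v ∩ VarOf a
  label-invariant a ε       = (λ z → z) , (λ z → z)
  label-invariant a (s ◅ r) =
    let (p , q) = isLocal a s ; (p′ , q′) = label-invariant a r
    in (λ z → p′ (p z)) , (λ z → q (q′ z))

  𝔥 : HypergraphModel S ℓ
  𝔥 = record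
    { G          = graph
    ; χ          = proj₁
    ; χ-resp     = λ { (same _) → refl }
    ; χ-coloring = coloring
    ; label      = λ (a , u) → V u ∩ VarOf a
    ; label-resp = λ { (same {a} r) → label-invariant a r }
    ; label-own  = λ { refl (_ , own) → own }
    }

  E : W → Edge
  E u = hyperedge u , u , ((λ z → z) , (λ z → z)) , ((λ z → z) , (λ z → z))

{-# OPTIONS --safe #-}

-- Every hyperedge of 𝔥 M is E_u for some world u, and the vertex of color a in
-- E_u is the R_a^≡-class of u.  Hence E_u ≈_a E_v iff u R_a^≡ v, and E_u ▷_a E_v
-- iff moreover v R_a v.  When R_a is transitive and Euclidean, u R_a^≡ v and
-- v R_a v together amount to u R_a v, so truth is preserved by induction on the
-- formula, over all presentations of a hyperedge at once.
module Submission where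

open import Defs
open import Axiom.ExcludedMiddle using (ExcludedMiddle)
open import Data.Product using (_×_; _,_; proj₁; proj₂; map)
open import Data.Sum using (inj₁; inj₂)
open import Function.Base using (_∘_)
open import Function.Bundles using (_⇔_; mk⇔; Equivalence)
open import Level using (Level; lift; lower)
open import Relation.Binary.Construct.Closure.Equivalence as Eq using (EqClosure)
open import Relation.Binary.Construct.Closure.ReflexiveTransitive using (ε; _◅_)
open import Relation.Binary.Construct.Closure.Symmetric using (fwd; bwd)
open import Relation.Binary.Core using (Rel)
open import Relation.Binary.Definitions using (Transitive)
open import Relation.Binary.PropositionalEquality using (refl)
open import Relation.Nullary using (yes; no)
open import Relation.Unary using (_∈_)

open Equivalence using (to; from)

-- The path is folded from its end: `vRv` starts the fold, transitivity absorbs a forward step, and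
-- the Euclidean property absorbs a backward step.
EqClosure-reflexivePoint : ∀ {a ℓ} {A : Set a} {R : Rel A ℓ} → Transitive R →
  (∀ {u v w} → R u v → R u w → R v w) →
  ∀ {u v} → EqClosure R u v → R v v → R u v
EqClosure-reflexivePoint tr eu ε            vRv = vRv
EqClosure-reflexivePoint tr eu (fwd uRm ◅ r) vRv = tr uRm (EqClosure-reflexivePoint tr eu r vRv)
EqClosure-reflexivePoint tr eu (bwd mRu ◅ r) vRv = eu mRu (EqClosure-reflexivePoint tr eu r vRv)

module _ {ℓ : Level} (em : ExcludedMiddle ℓ) {S : Signature} (M : KripkeModel S ℓ)
         (isLocal : IsLocal M) where
  open Signature S
  open KripkeModel M
  open Associated em M isLocal
  open HypergraphModel 𝔥 using (Edge; U; labelᴱ; _▷⟨_⟩_; _≈⟨_⟩_)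

  -- Membership in `ℰ` already carries a world, so no choice is made here.
  world : Edge → W
  world e = proj₁ (proj₂ e)

  ~⇒R≡ : ∀ {a b u v} → (a , u) ~ (b , v) → u R≡⟨ a ⟩ v
  ~⇒R≡ (same r) = r

  -- Excluded middle decides whether the class of color `a` lies in the tail or in the head.
  ∈U : ∀ e {a v} → v R≡⟨ a ⟩ world e → (a , v) ∈ U e
  ∈U (_ , u , (_ , X⊆T) , (_ , Y⊆H)) {a} r with em {P = R a u u}
  ... | yes uRu  = inj₁ (X⊆T (a , uRu , same r))
  ... | no  ¬uRu = inj₂ (Y⊆H (a , ¬uRu , same r))

  labelᴱ⇔V : ∀ e {p} → p ∈ V (world e) ⇔ p ∈ labelᴱ e
  labelᴱ⇔V e {p} = mk⇔
    -- Only the vertex colored by the owner of `p` can carry `p`.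
    (λ p∈V → (proj₁ p , world e) , ∈U e (Eq.reflexive _) , p∈V , refl)
    (λ { ((a , _) , x∈U , p∈x) →
      proj₁ (proj₁ (label-invariant a (~⇒R≡ (edge-class e x∈U))) p∈x) })

  ≈⇔R≡ : ∀ {a} e e′ → e ≈⟨ a ⟩ e′ ⇔ world e R≡⟨ a ⟩ world e′
  ≈⇔R≡ {a} e e′ = mk⇔
    (λ { (_ , (x∈ , x∈′) , refl) →
      Eq.transitive _ (Eq.symmetric _ (~⇒R≡ (edge-class e x∈))) (~⇒R≡ (edge-class e′ x∈′)) })
    (λ r → (a , world e) , (∈U e (Eq.reflexive _) , ∈U e′ r) , refl)

  module _ (isTransitive : IsTransitive M) (isEuclidean : IsEuclidean M) where

    ▷⇔R : ∀ {a} e e′ → e ▷⟨ a ⟩ e′ ⇔ R a (world e) (world e′)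
    ▷⇔R {a} e e′@(_ , v , (T⊆X , X⊆T) , _) = mk⇔ ⇒R ⇒▷
      where
      ⇒R : e ▷⟨ a ⟩ e′ → R a (world e) v
      -- Lying in the tail of `e′` means that `v` is reflexive for the color of `x`.
      ⇒R (x , (x∈U , x∈T) , refl) with T⊆X x∈T
      ... | _ , vRv , same _ = EqClosure-reflexivePoint (isTransitive a) (isEuclidean a)
              (to (≈⇔R≡ e e′) (x , (x∈U , inj₁ x∈T) , refl)) vRv
      ⇒▷ : R a (world e) v → e ▷⟨ a ⟩ e′
      -- Two copies of `r` give `R a v v` by the Euclidean property, which places the shared vertex
      -- in the tail.
      ⇒▷ r = (a , world e)
           , (∈U e (Eq.reflexive _) , X⊆T (a , isEuclidean a r r , same (Eq.return r)))
           , refl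

    -- The edge is arbitrary because the modal clauses range over edges that match some `E v` only
    -- up to `≋`.
    ⊨ᴷ⇔⊨ᴴ : ∀ φ e → (M ⨾ world e ⊨ᴷ φ) ⇔ (𝔥 ⨾ e ⊨ᴴ φ)
    ⊨ᴷ⇔⊨ᴴ (var p) e = mk⇔ (lift ∘ to (labelᴱ⇔V e)) (from (labelᴱ⇔V e) ∘ lower)
    ⊨ᴷ⇔⊨ᴴ (neg φ) e = mk⇔ (_∘ from (⊨ᴷ⇔⊨ᴴ φ e)) (_∘ to (⊨ᴷ⇔⊨ᴴ φ e))
    ⊨ᴷ⇔⊨ᴴ (φ ∧ ψ) e = mk⇔ (map (to (⊨ᴷ⇔⊨ᴴ φ e)) (to (⊨ᴷ⇔⊨ᴴ ψ e)))
                          (map (from (⊨ᴷ⇔⊨ᴴ φ e)) (from (⊨ᴷ⇔⊨ᴴ ψ e)))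
    ⊨ᴷ⇔⊨ᴴ (B a φ) e = mk⇔
      (λ f e′ s → to (⊨ᴷ⇔⊨ᴴ φ e′) (f (world e′) (to (▷⇔R e e′) s)))
      -- Here the edge `E v` suffices, as its `world` is `v` by definition.
      (λ f v r → from (⊨ᴷ⇔⊨ᴴ φ (E v)) (f (E v) (from (▷⇔R e (E v)) r)))
    ⊨ᴷ⇔⊨ᴴ (K a φ) e = mk⇔
      (λ f e′ s → to (⊨ᴷ⇔⊨ᴴ φ e′) (f (world e′) (to (≈⇔R≡ e e′) s)))
      (λ f v r → from (⊨ᴷ⇔⊨ᴴ φ (E v)) (f (E v) (from (≈⇔R≡ e (E v)) r)))

proposition4 : ∀ {ℓ : Level} (em : ExcludedMiddle ℓ) {S : Signature}
    (M : KripkeModel S ℓ) (w : KripkeModel.W M) →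
    ((M∈Kte : InKte M) → let open Associated em M (InKte.isLocal M∈Kte) in
    ∀ (φ : Formula S) → KFree φ → ((M ⨾ w ⊨ᴷ φ) ⇔ (𝔥 ⨾ E w ⊨ᴴ φ)))
    ×
    ((M∈Kste : InKste M) → let open Associated em M (InKste.isLocal M∈Kste) in
    ∀ (φ : Formula S) → ((M ⨾ w ⊨ᴷ φ) ⇔ (𝔥 ⨾ E w ⊨ᴴ φ)))
proposition4 em M w =
    (λ M∈Kte φ _ →
      ⊨ᴷ⇔⊨ᴴ em M (InKte.isLocal M∈Kte) (InKte.isTransitive M∈Kte) (InKte.isEuclidean M∈Kte) φ
        (Associated.E em M (InKte.isLocal M∈Kte) w))
  , (λ M∈Kste φ →
      ⊨ᴷ⇔⊨ᴴ em M (InKste.isLocal M∈Kste) (InKste.isTransitive M∈Kste) (InKste.isEuclidean M∈Kste) φ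
        (Associated.E em M (InKste.isLocal M∈Kste) w))
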